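{- Let $n\ge 2$ with $n\equiv 0\pmod 4$. Then the number of equiparity Latin squares in the ensemble of any $\mathrm{OA}(n+1,n)$ is even and at least $n(n+1)(n-4)/24$.
   Context: An orthogonal array $\mathrm{OA}(k,n)$ on an alphabet $\Lambda$ with $|\Lambda|=n$ is an $n^2\times k$ matrix $A=(a_{r\ell})$ with entries in $\Lambda$ such that in every pair of distinct columns each ordered pair in $\Lambda^2$ occurs in exactly one row. The ensemble of $A$ is the family of Latin squares indexed by the $\binom{k}{3}$ choices of columns $i<j<\ell$ of $A$ (Latin squares are counted once for each choice of three columns): the Latin square for $i<j<\ell$ has rows and columns indexed by $\Lambda$, and for each row $r$ of $A$ its entry in row $a_{ri}$, column $a_{rj}$ is $a_{r\ell}$. For a Latin square $L=(l_{xy})$ with rows, columns and symbols indexed by $\Lambda$, the row-parity $\pi_r\in\mathbb{Z}_2$ is the sum of the parities ($0$ even, $1$ odd) of the $n$ permutations $y\mapsto l_{xy}$ ($x\in\Lambda$ fixed); the column-parity $\pi_c$ is the sum of the parities of the $n$ permutations $x\mapsto l_{xy}$ ($y$ fixed); the symbol-parity $\pi_s$ is the sum of the parities of the $n$ permutations mapping $x\mapsto y$ whenever $l_{xy}=s$ ($s$ fixed). $L$ is equiparity if $\pi_r=\pi_c=\pi_s$. -}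

module Defs where

open import Data.Fin.Base using (Fin; _<_)
open import Data.Fin.Permutation using (Permutation′; _⟨$⟩ʳ_)
open import Data.Fin.Properties using (_<?_; <⇒≢; <-trans)
open import Data.List.Base using (List; allFin; cartesianProduct; filter; length; map; mapMaybe)
open import Data.Maybe.Base using (Maybe)
import Data.Maybe.Base as Maybe
open import Data.Nat.Base using (ℕ; _^_; parity)
open import Data.Parity.Base using (Parity)
import Data.Parity.Properties as ℙ
open import Data.Product using (_×_; _,_; ∃!; proj₁; proj₂)
open import Function.Base using (_∘_)
open import Function.Bundles using (_↔_; Inverse; mk↔ₛ′)
open import Function.Construct.Composition using (_↔-∘_)
open import Function.Construct.Symmetry using (↔-sym)
open import Relation.Binary.PropositionalEquality
  using (_≡_; _≢_; refl; sym; trans; cong)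
open import Relation.Nullary.Decidable using (Dec; dec⇒maybe; _×-dec_)

open import Algebra.Properties.CommutativeMonoid.Sum ℙ.+-0-commutativeMonoid using (sum)

Inversion : ∀ {n} → Permutation′ n → Fin n × Fin n → Set
Inversion π (i , j) = i < j × (π ⟨$⟩ʳ j) < (π ⟨$⟩ʳ i)

inversion? : ∀ {n} (π : Permutation′ n) p → Dec (Inversion π p)
inversion? π (i , j) = (i <? j) ×-dec ((π ⟨$⟩ʳ j) <? (π ⟨$⟩ʳ i))

permParity : ∀ {n} → Permutation′ n → Parity
permParity {n} π =
  parity (length (filter (inversion? π) (cartesianProduct (allFin n) (allFin n))))

record LatinSquare (Λ : Set) : Set where
  field
    entry     : Λ → Λ → Λ
    rowUnique : ∀ x s → ∃! _≡_ λ y → entry x y ≡ s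
    colUnique : ∀ y s → ∃! _≡_ λ x → entry x y ≡ s

  -- y ↦ entry x y
  rowPerm : Λ → Λ ↔ Λ
  rowPerm x = mk↔ₛ′ (entry x) (λ s → proj₁ (rowUnique x s))
    (λ s → proj₁ (proj₂ (rowUnique x s)))
    (λ y → proj₂ (proj₂ (rowUnique x (entry x y))) refl)

  -- x ↦ entry x y
  colPerm : Λ → Λ ↔ Λ
  colPerm y = mk↔ₛ′ (λ x → entry x y) (λ s → proj₁ (colUnique y s))
    (λ s → proj₁ (proj₂ (colUnique y s)))
    (λ x → proj₂ (proj₂ (colUnique y (entry x y))) refl)

  -- x ↦ the y with entry x y ≡ s
  symPerm : Λ → Λ ↔ Λ
  symPerm s = mk↔ₛ′ (λ x → proj₁ (rowUnique x s)) (λ y → proj₁ (colUnique y s))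
    (λ y → proj₂ (proj₂ (rowUnique _ s)) (proj₁ (proj₂ (colUnique y s))))
    (λ x → proj₂ (proj₂ (colUnique _ s)) (proj₁ (proj₂ (rowUnique x s))))

-- The enumeration says |Λ| = n. A permutation of Λ gets its parity by
-- transport to Fin n; this does not depend on the enumeration, since
-- parity is invariant under conjugation.
module _ {n : ℕ} {Λ : Set} (enum : Λ ↔ Fin n) where

  open LatinSquare

  parityΛ : Λ ↔ Λ → Parity
  parityΛ σ = permParity (enum ↔-∘ (σ ↔-∘ ↔-sym enum))

  sumΛ : (Λ → Parity) → Parity
  sumΛ f = sum (f ∘ Inverse.from enum)

  rowParity colParity symParity : LatinSquare Λ → Parity
  rowParity L = sumΛ λ x → parityΛ (rowPerm L x)
  colParity L = sumΛ λ y → parityΛ (colPerm L y)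
  symParity L = sumΛ λ s → parityΛ (symPerm L s)

  Equiparity : LatinSquare Λ → Set
  Equiparity L = rowParity L ≡ colParity L × colParity L ≡ symParity L

  equiparity? : ∀ L → Dec (Equiparity L)
  equiparity? L =
    (rowParity L ℙ.≟ colParity L) ×-dec (colParity L ℙ.≟ symParity L)

-- OA(k,n) on Λ. The assumption |Λ| = n is supplied separately.
record OrthogonalArray (k n : ℕ) (Λ : Set) : Set where
  field
    array      : Fin (n ^ 2) → Fin k → Λ
    orthogonal : ∀ {i j} → i ≢ j → ∀ x y →
                 ∃! _≡_ λ r → array r i ≡ x × array r j ≡ y

  theRow : ∀ {i j} → i ≢ j → Λ → Λ → Fin (n ^ 2)
  theRow i≢j x y = proj₁ (orthogonal i≢j x y)

  latinSquare : ∀ {i j l} → i ≢ j → i ≢ l → j ≢ l → LatinSquare Λ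
  latinSquare {i} {j} {l} i≢j i≢l j≢l = record
    { entry     = entry
    ; rowUnique = λ x s →
        let r , (rᵢ , rₗ) , r! = orthogonal i≢l x s in
        array r j
        , trans (cong (λ r′ → array r′ l) (unique rᵢ refl)) rₗ
        , λ {y} e → trans (cong (λ r′ → array r′ j) (r! (atᵢ x y , e))) (atⱼ x y)
    ; colUnique = λ y s →
        let r , (rⱼ , rₗ) , r! = orthogonal j≢l y s in
        array r i
        , trans (cong (λ r′ → array r′ l) (unique refl rⱼ)) rₗ
        , λ {x} e → trans (cong (λ r′ → array r′ i) (r! (atⱼ x y , e))) (atᵢ x y)
    }
    where
    entry : Λ → Λ → Λ
    entry x y = array (theRow i≢j x y) l

    atᵢ : ∀ x y → array (theRow i≢j x y) i ≡ x
    atᵢ x y = proj₁ (proj₁ (proj₂ (orthogonal i≢j x y)))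

    atⱼ : ∀ x y → array (theRow i≢j x y) j ≡ y
    atⱼ x y = proj₂ (proj₁ (proj₂ (orthogonal i≢j x y)))

    unique : ∀ {x y r} → array r i ≡ x → array r j ≡ y → theRow i≢j x y ≡ r
    unique {x} {y} p q = proj₂ (proj₂ (orthogonal i≢j x y)) (p , q)

record Triple (k : ℕ) : Set where
  constructor triple
  field
    {i j l} : Fin k
    i<j     : i < j
    j<l     : j < l

toTriple : ∀ {k} → Fin k × Fin k × Fin k → Maybe (Triple k)
toTriple (i , j , l) =
  Maybe.map (λ (i<j , j<l) → triple i<j j<l) (dec⇒maybe ((i <? j) ×-dec (j <? l)))

triples : ∀ k → List (Triple k)
triples k =
  mapMaybe toTriple (cartesianProduct (allFin k) (cartesianProduct (allFin k) (allFin k)))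

-- A list, so that equal Latin squares from different triples of columns
-- are counted separately.
ensemble : ∀ {k n Λ} → OrthogonalArray k n Λ → List (LatinSquare Λ)
ensemble {k} A = map square (triples k)
  where
  square : Triple k → LatinSquare _
  square (triple i<j j<l) = OrthogonalArray.latinSquare A
    (<⇒≢ i<j) (<⇒≢ (<-trans i<j j<l)) (<⇒≢ j<l)

equiparityCount : ∀ {k n Λ} → Λ ↔ Fin n → OrthogonalArray k n Λ → ℕ
equiparityCount enum A = length (filter (equiparity? enum) (ensemble A))

{-# OPTIONS --safe #-}

-- For columns c and a let v c a be the parity of the number of pairs of rows
-- r < s of the array that agree in c and are inverted in a, and let inv a count
-- all pairs inverted in a. The permutations from column a to column b over the
-- symbols of c have total parity v c a + v c b. Pairs of rows that differ in both
-- i and j are ordered oppositely by i and j in C(n,2)² cases, an even number, so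
-- v i j + v j i = inv i + inv j. Hence e i j = v i j + inv i is a graph on the
-- columns, the three parities of a Latin square are the sums of e over the pairs
-- of edges of its triangle that meet in a vertex, and equiparity squares are
-- exactly the monochromatic triangles of e and its complement.
--
-- In a complete array any two rows agree exactly once, so Σ_c v c b = inv b and
-- all degrees of e are congruent to Σ_c inv c. The handshake lemma on an odd number
-- of vertices makes them even. Goodman's count
--   6 #mono = (n+1)n(n-1) - 3 Σ_i d_i (n - d_i)
-- gives the bound from 4 d (n - d) ≤ n² and evenness from 4 | d_i (n - d_i).
module Submission where

open import Defs
open import Algebra.Bundles using (CommutativeSemiring)
open import Data.Bool.Base using (Bool; true; false; _∧_; not; if_then_else_)
open import Data.Empty using (⊥; ⊥-elim)
open import Data.Fin.Base using (Fin; zero; suc; _<_)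
open import Data.Fin.Permutation using (Permutation′; _⟨$⟩ʳ_)
open import Data.Fin.Properties
  using (_<?_; _≟_; any?; <-irrefl; <-cmp; <-trans; <⇒≢; pigeonhole; suc-injective)
open import Data.List.Base
  using (List; []; _∷_; _++_; allFin; cartesianProduct; filter; length; map; mapMaybe; tabulate)
open import Data.List.Properties using (map-++; map-∘)
open import Data.Maybe.Base as Maybe using (Maybe; just; nothing; maybe′)
open import Data.Nat.Base as ℕ using (ℕ; zero; suc; z≤n; s≤s; parity)
open import Data.Nat.Divisibility
import Data.Nat.ListAction as List
import Data.Nat.ListAction.Properties as List
import Data.Nat.Properties as ℕ
open import Data.Nat.Tactic.RingSolver using (solve-∀)
open import Data.Parity.Base using (Parity; 0ℙ; 1ℙ; _⁻¹)
import Data.Parity.Base as ℙ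
import Data.Parity.Properties as ℙ
open import Data.Product using (_×_; _,_; proj₁; proj₂; ∃)
open import Data.Sum.Base using (inj₁; inj₂)
open import Function.Base using (_∘_; case_of_; id)
open import Function.Bundles using (_↔_; Inverse)
open import Function.Construct.Composition using (_↔-∘_)
open import Function.Construct.Symmetry using (↔-sym)
open import Relation.Binary.Definitions using (tri<; tri≈; tri>)
open import Relation.Binary.PropositionalEquality
  using (_≡_; _≢_; refl; sym; trans; cong; cong₂; subst; module ≡-Reasoning)
open import Relation.Nullary using (Dec; yes; no; does; ¬_; contradiction)
open import Relation.Nullary.Decidable using (dec-true; dec-false; dec⇒maybe; _×-dec_)

-- Finite sums over a commutative semiring.

module FiniteSums {c ℓ} (R : CommutativeSemiring c ℓ) where
  open CommutativeSemiring R hiding (zero; refl; sym; trans)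
  private module S = CommutativeSemiring R
  open import Algebra.Properties.Semiring.Sum semiring public
  open import Relation.Binary.Reasoning.Setoid setoid

  𝟙 : Bool → Carrier
  𝟙 true  = 1#
  𝟙 false = 0#

  ∑-zero : ∀ {n} {f : Fin n → Carrier} → (∀ i → f i ≈ 0#) → sum f ≈ 0#
  ∑-zero {n} f≈0 = S.trans (sum-cong-≋ f≈0) (sum-replicate-zero n)

  ∑-select : ∀ {n} (i : Fin n) (f : Fin n → Carrier) →
             sum (λ j → 𝟙 (does (i ≟ j)) * f j) ≈ f i
  ∑-select zero f = begin
    1# * f zero + sum (λ j → 0# * f (suc j))
      ≈⟨ +-cong (*-identityˡ _) (∑-zero (λ j → zeroˡ (f (suc j)))) ⟩
    f zero + 0#
      ≈⟨ +-identityʳ _ ⟩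
    f zero ∎
  ∑-select (suc i) f = begin
    0# * f zero + sum (λ j → 𝟙 (does (i ≟ j)) * f (suc j))
      ≈⟨ +-cong (zeroˡ _) (∑-select i (f ∘ suc)) ⟩
    0# + f (suc i)
      ≈⟨ +-identityˡ _ ⟩
    f (suc i) ∎

  ∑∑-distrib-+ : ∀ {m n} (A B : Fin m → Fin n → Carrier) →
    sum (λ i → sum λ j → A i j + B i j) ≈ sum (λ i → sum (A i)) + sum (λ i → sum (B i))
  ∑∑-distrib-+ A B =
    S.trans (sum-cong-≋ (λ i → ∑-distrib-+ (A i) (B i)))
            (∑-distrib-+ (sum ∘ A) (sum ∘ B))

  ∑∑-* : ∀ {m n} (f : Fin m → Carrier) (g : Fin n → Carrier) →
        sum (λ i → sum λ j → f i * g j) ≈ sum f * sum g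
  ∑∑-* f g = S.trans (sum-cong-≋ (λ i → S.sym (*-distribˡ-sum (f i) g)))
                    (S.sym (*-distribʳ-sum (sum g) f))

  -- Grouping the terms at (i, j) and (j, i) lets two double sums be compared one unordered pair at
  -- a time. This serves inversion counts, where each sum orders a pair in its own way and single
  -- terms do not match. The induction peels off the first row and column.
  ∑∑-pairs : ∀ {n} (A B : Fin n → Fin n → Carrier) →
    (∀ i → A i i ≈ B i i) →
    (∀ {i j} → i ≢ j → A i j + A j i ≈ B i j + B j i) →
    sum (λ i → sum (A i)) ≈ sum (λ i → sum (B i))
  ∑∑-pairs {zero} A B diag off = S.refl
  ∑∑-pairs {suc n} A B diag off = begin
    sum (λ i → sum (A i))   ≈⟨ split A ⟩
    A zero zero + border A + core A
      ≈⟨ +-cong (+-cong (diag zero) (sum-cong-≋ (λ i → off {zero} {suc i} λ ())))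
                (∑∑-pairs _ _ (diag ∘ suc) (λ i≢j → off (i≢j ∘ suc-injective))) ⟩
    B zero zero + border B + core B
      ≈⟨ split B ⟨
    sum (λ i → sum (B i))   ∎
    where
    border core : (Fin (suc n) → Fin (suc n) → Carrier) → Carrier
    border C = sum (λ i → C zero (suc i) + C (suc i) zero)
    core C = sum (λ i → sum λ j → C (suc i) (suc j))

    split : ∀ C → sum (λ i → sum (C i)) ≈ C zero zero + border C + core C
    split C = begin
      C zero zero + sum (C zero ∘ suc) + sum (λ i → C (suc i) zero + sum (C (suc i) ∘ suc))
        ≈⟨ +-congˡ (∑-distrib-+ (λ i → C (suc i) zero) _) ⟩
      C zero zero + sum (C zero ∘ suc) + (sum (λ i → C (suc i) zero) + core C)
        ≈⟨ +-assoc _ _ _ ⟨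
      C zero zero + sum (C zero ∘ suc) + sum (λ i → C (suc i) zero) + core C
        ≈⟨ +-congʳ (+-assoc _ _ _) ⟩
      C zero zero + (sum (C zero ∘ suc) + sum (λ i → C (suc i) zero)) + core C
        ≈⟨ +-congʳ (+-congˡ (∑-distrib-+ (λ i → C zero (suc i)) _)) ⟨
      C zero zero + border C + core C ∎

-- Comparisons, and counts over lists as finite sums.

<?-flip : ∀ {n} {x y : Fin n} → x ≢ y → does (y <? x) ≡ not (does (x <? y))
<?-flip {x = x} {y} x≢y with <-cmp x y
... | tri< x<y _ y≮x rewrite dec-true (x <? y) x<y = dec-false (y <? x) y≮x
... | tri≈ _ x≡y _ = contradiction x≡y x≢y
... | tri> x≮y _ y<x rewrite dec-false (x <? y) x≮y = dec-true (y <? x) y<x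

module ℕ∑ = FiniteSums ℕ.+-*-commutativeSemiring

length-filter : ∀ {a p} {A : Set a} {P : A → Set p} (P? : ∀ x → Dec (P x)) xs →
                length (filter P? xs) ≡ List.sum (map (ℕ∑.𝟙 ∘ does ∘ P?) xs)
length-filter P? [] = refl
length-filter P? (x ∷ xs) with does (P? x)
... | true  = cong suc (length-filter P? xs)
... | false = length-filter P? xs

-- The left side has the shape of `equiparityCount`: a filter of the squares built from the triples
-- that `toTriple` accepts. A rejected candidate weighs 0.
length-filter-mapMaybe : ∀ {A B C : Set} {P : C → Set} (P? : ∀ x → Dec (P x))
  (f : B → C) (g : A → Maybe B) xs →
  length (filter P? (map f (mapMaybe g xs))) ≡
  List.sum (map (λ x → maybe′ (λ t → ℕ∑.𝟙 (does (P? (f t)))) 0 (g x)) xs)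
length-filter-mapMaybe P? f g [] = refl
length-filter-mapMaybe P? f g (x ∷ xs) with g x
... | nothing = length-filter-mapMaybe P? f g xs
... | just t with does (P? (f t))
...   | true  = cong suc (length-filter-mapMaybe P? f g xs)
...   | false = length-filter-mapMaybe P? f g xs

sum-tabulate : ∀ {A : Set} {n} (f : Fin n → A) (g : A → ℕ) →
               List.sum (map g (tabulate f)) ≡ ℕ∑.sum (g ∘ f)
sum-tabulate {n = zero}  f g = refl
sum-tabulate {n = suc n} f g = cong (g (f zero) ℕ.+_) (sum-tabulate (f ∘ suc) g)

sum-cartesianProduct : ∀ {A B : Set} {n} (f : Fin n → A) (ys : List B) (g : A × B → ℕ) →
  List.sum (map g (cartesianProduct (tabulate f) ys)) ≡
  ℕ∑.sum λ i → List.sum (map (λ y → g (f i , y)) ys)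
sum-cartesianProduct {n = zero}  f ys g = refl
sum-cartesianProduct {n = suc n} f ys g = begin
  List.sum (map g (map (f zero ,_) ys ++ rest))
    ≡⟨ cong List.sum (map-++ g (map (f zero ,_) ys) rest) ⟩
  List.sum (map g (map (f zero ,_) ys) ++ map g rest)
    ≡⟨ List.sum-++ (map g (map (f zero ,_) ys)) (map g rest) ⟩
  List.sum (map g (map (f zero ,_) ys)) ℕ.+ List.sum (map g rest)
    ≡⟨ cong₂ (λ l m → List.sum l ℕ.+ m) (sym (map-∘ ys)) (sum-cartesianProduct (f ∘ suc) ys g) ⟩
  ℕ∑.sum (λ i → List.sum (map (λ y → g (f i , y)) ys)) ∎
  where
  open ≡-Reasoning
  rest = cartesianProduct (tabulate (f ∘ suc)) ys

-- Sums modulo 2, numbers of pairs and parities of permutations.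

module Parities where
  open import Algebra.Properties.CommutativeSemigroup ℙ.+-commutativeSemigroup using (interchange)
  -- Data.Parity.Base declares _+_ and _*_ with equal precedence.
  open CommutativeSemiring ℙ.+-*-commutativeSemiring using (_+_; _*_)
  open FiniteSums ℙ.+-*-commutativeSemiring public
  open ≡-Reasoning

  infix 8 _⊏_ _≐_
  _⊏_ _≐_ : ∀ {n} → Fin n → Fin n → Parity
  x ⊏ y = 𝟙 (does (x <? y))
  x ≐ y = 𝟙 (does (x ≟ y))

  ⊏-irrefl : ∀ {n} (x : Fin n) → x ⊏ x ≡ 0ℙ
  ⊏-irrefl x = cong 𝟙 (dec-false (x <? x) (<-irrefl refl))

  ⊏-flip : ∀ {n} {x y : Fin n} → x ≢ y → y ⊏ x ≡ (x ⊏ y) ⁻¹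
  ⊏-flip {x = x} {y} x≢y = trans (cong 𝟙 (<?-flip x≢y)) (𝟙-not (does (x <? y)))
    where
    𝟙-not : ∀ p → 𝟙 (not p) ≡ 𝟙 p ⁻¹
    𝟙-not false = refl
    𝟙-not true  = refl

  ≐-≡ : ∀ {n} {x y : Fin n} → x ≡ y → x ≐ y ≡ 1ℙ
  ≐-≡ {x = x} {y} x≡y = cong 𝟙 (dec-true (x ≟ y) x≡y)

  ≐-≢ : ∀ {n} {x y : Fin n} → x ≢ y → x ≐ y ≡ 0ℙ
  ≐-≢ {x = x} {y} x≢y = cong 𝟙 (dec-false (x ≟ y) x≢y)

  ∑-const : ∀ m x → sum {m} (λ _ → x) ≡ parity m * x
  ∑-const zero x = refl
  ∑-const (suc m) x = begin
    x + sum {m} (λ _ → x)   ≡⟨ cong (x +_) (∑-const m x) ⟩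
    x + parity m * x        ≡⟨ one-more (parity m) x ⟩
    parity m ⁻¹ * x         ≡⟨ cong (λ p → p ⁻¹ * x) (ℙ.suc-homo-⁻¹ m) ⟨
    parity (suc m) ⁻¹ ⁻¹ * x ≡⟨ cong (_* x) (ℙ.⁻¹-involutive (parity (suc m))) ⟩
    parity (suc m) * x      ∎
    where
    one-more : ∀ p x → x + p * x ≡ p ⁻¹ * x
    one-more 0ℙ x = ℙ.+-identityʳ x
    one-more 1ℙ x = ℙ.p+p≡0ℙ x

  -- The binomial coefficient C(n,2) modulo 2.
  pairs : ℕ → Parity
  pairs n = sum {n} λ x → sum {n} λ y → x ⊏ y

  pairs-suc : ∀ n → pairs (suc n) ≡ parity n + pairs n
  pairs-suc n = cong (_+ pairs n) (trans (∑-const n 1ℙ) (ℙ.*-identityʳ (parity n)))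

  pairs-4∣ : ∀ {n} → 4 ∣ n → pairs n ≡ 0ℙ
  pairs-4∣ (divides zero refl) = refl
  pairs-4∣ (divides (suc q) refl) = begin
    -- C(m+4,2) exceeds C(m,2) by m + (m+1) + (m+2) + (m+3). Since `parity` computes in steps of
    -- two, this is the parities of m and m+1, each taken twice.
    pairs (4 ℕ.+ m)
      ≡⟨ pairs-suc (3 ℕ.+ m) ⟩
    parity (1 ℕ.+ m) + pairs (3 ℕ.+ m)
      ≡⟨ cong (parity (1 ℕ.+ m) +_) (pairs-suc (2 ℕ.+ m)) ⟩
    parity (1 ℕ.+ m) + (parity m + pairs (2 ℕ.+ m))
      ≡⟨ cong (λ p → parity (1 ℕ.+ m) + (parity m + p)) (pairs-suc (1 ℕ.+ m)) ⟩
    parity (1 ℕ.+ m) + (parity m + (parity (1 ℕ.+ m) + pairs (1 ℕ.+ m)))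
      ≡⟨ cong (λ p → parity (1 ℕ.+ m) + (parity m + (parity (1 ℕ.+ m) + p))) (pairs-suc m) ⟩
    parity (1 ℕ.+ m) + (parity m + (parity (1 ℕ.+ m) + (parity m + pairs m)))
      ≡⟨ twice (parity (1 ℕ.+ m)) (parity m) ⟩
    pairs m
      ≡⟨ pairs-4∣ (divides q refl) ⟩
    0ℙ ∎
    where
    m = q ℕ.* 4
    twice : ∀ p q {x} → p + (q + (p + (q + x))) ≡ x
    twice 0ℙ 0ℙ = refl
    twice 0ℙ 1ℙ = ℙ.⁻¹-involutive _
    twice 1ℙ 0ℙ = ℙ.⁻¹-involutive _
    twice 1ℙ 1ℙ = trans (ℙ.⁻¹-involutive _) (ℙ.⁻¹-involutive _)

  parity-∑ : ∀ {n} (f : Fin n → ℕ) → parity (ℕ∑.sum f) ≡ sum (parity ∘ f)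
  parity-∑ {zero} f = refl
  parity-∑ {suc n} f =
    trans (ℙ.+-homo-+ (f zero) (ℕ∑.sum (f ∘ suc)))
          (cong (parity (f zero) +_) (parity-∑ (f ∘ suc)))

  permParity≡∑ : ∀ {n} (π : Permutation′ n) →
    permParity π ≡ sum λ i → sum λ j → i ⊏ j * (π ⟨$⟩ʳ j) ⊏ (π ⟨$⟩ʳ i)
  permParity≡∑ {n} π = begin
    permParity π
      ≡⟨ cong parity (length-filter (inversion? π) (cartesianProduct (allFin n) (allFin n))) ⟩
    parity (List.sum (map inverted (cartesianProduct (allFin n) (allFin n))))
      ≡⟨ cong parity (sum-cartesianProduct id (allFin n) inverted) ⟩
    parity (ℕ∑.sum λ i → List.sum (map (λ j → inverted (i , j)) (allFin n)))
      ≡⟨ cong parity (ℕ∑.sum-cong-≗ (λ i → sum-tabulate id (λ j → inverted (i , j)))) ⟩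
    parity (ℕ∑.sum λ i → ℕ∑.sum λ j → inverted (i , j))
      ≡⟨ parity-∑ (λ i → ℕ∑.sum λ j → inverted (i , j)) ⟩
    sum (λ i → parity (ℕ∑.sum λ j → inverted (i , j)))
      ≡⟨ sum-cong-≗ (λ i → parity-∑ (λ j → inverted (i , j))) ⟩
    sum (λ i → sum λ j → parity (inverted (i , j)))
      ≡⟨ sum-cong-≗ (λ i → sum-cong-≗ λ j → both (does (i <? j)) (does ((π ⟨$⟩ʳ j) <? (π ⟨$⟩ʳ i)))) ⟩
    sum (λ i → sum λ j → i ⊏ j * (π ⟨$⟩ʳ j) ⊏ (π ⟨$⟩ʳ i)) ∎
    where
    inverted : Fin n × Fin n → ℕ
    inverted = ℕ∑.𝟙 ∘ does ∘ inversion? π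

    both : ∀ p q → parity (ℕ∑.𝟙 (p ∧ q)) ≡ 𝟙 p * 𝟙 q
    both false q     = refl
    both true  false = refl
    both true  true  = refl

  -- The graph on the columns and its even degrees.

  module Graph {k : ℕ} (odd : parity k ≡ 1ℙ)
    (V : Fin k → Fin k → Parity) (I : Fin k → Parity)
    (V-diag : ∀ i → V i i ≡ 0ℙ)
    (V-flip : ∀ {i j} → i ≢ j → V i j + V j i ≡ I i + I j)
    (∑-V : ∀ j → sum (λ i → V i j) ≡ I j)
    where

    -- The factor with `≐` removes loops. Its arguments are in the order j, i so that a sum of
    -- `e j i` over j has the form that `∑-select i` expects.
    e : Fin k → Fin k → Parity
    e i j = V i j + (j ≐ i) ⁻¹ * I i

    e-diag : ∀ i → e i i ≡ 0ℙ
    e-diag i = cong₂ (λ p q → p + q ⁻¹ * I i) (V-diag i) (≐-≡ {x = i} refl)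

    e-off : ∀ {i j} → i ≢ j → e i j ≡ V i j + I i
    e-off {i} {j} i≢j = cong (λ p → V i j + p ⁻¹ * I i) (≐-≢ (i≢j ∘ sym))

    -- By `V-flip` the asymmetry of V is I i + I j, and adding I of the first vertex cancels it.
    e-sym-≢ : ∀ {i j} → i ≢ j → e i j ≡ e j i
    e-sym-≢ {i} {j} i≢j = begin
      e i j         ≡⟨ e-off i≢j ⟩
      V i j + I i   ≡⟨ balance (V i j) (V j i) (I i) (I j) (V-flip i≢j) ⟩
      V j i + I j   ≡⟨ e-off (i≢j ∘ sym) ⟨
      e j i         ∎
      where
      balance : ∀ p q x y → p + q ≡ x + y → p + x ≡ q + y
      balance 0ℙ q 0ℙ y refl = sym (ℙ.p+p≡0ℙ q)
      balance 0ℙ q 1ℙ y refl = sym (ℙ.p⁻¹+p≡1ℙ y)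
      balance 1ℙ q 0ℙ y refl = sym (ℙ.p+p⁻¹≡1ℙ q)
      balance 1ℙ q 1ℙ y eq rewrite ℙ.⁻¹-injective eq = sym (ℙ.p+p≡0ℙ y)

    e-sym : ∀ i j → e i j ≡ e j i
    e-sym i j = case i ≟ j of λ where
      (yes i≡j) → cong₂ e i≡j (sym i≡j)
      (no i≢j)  → e-sym-≢ i≢j

    -- The correction I c enters twice and cancels. This turns the parity of a square into a sum of
    -- two edges at the vertex c.
    V+V≡e+e : ∀ {c a b} → c ≢ a → c ≢ b → V c a + V c b ≡ e c a + e c b
    V+V≡e+e {c} {a} {b} c≢a c≢b = begin
      V c a + V c b                   ≡⟨ ℙ.+-identityʳ _ ⟨
      V c a + V c b + 0ℙ              ≡⟨ cong (V c a + V c b +_) (ℙ.p+p≡0ℙ (I c)) ⟨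
      V c a + V c b + (I c + I c)     ≡⟨ interchange (V c a) (V c b) (I c) (I c) ⟩
      (V c a + I c) + (V c b + I c)   ≡⟨ cong₂ _+_ (e-off c≢a) (e-off c≢b) ⟨
      e c a + e c b                   ∎

    -- By symmetry the degree is a sum over the first argument. There the V terms add up to I i,
    -- which is just the term missing from the sum of I j over j ≠ i.
    degree-const : ∀ i → sum (e i) ≡ sum I
    degree-const i = begin
      sum (e i)
        ≡⟨ sum-cong-≗ (e-sym i) ⟩
      sum (λ j → V j i + (i ≐ j) ⁻¹ * I j)
        ≡⟨ ∑-distrib-+ (λ j → V j i) _ ⟩
      sum (λ j → V j i) + sum (λ j → (i ≐ j) ⁻¹ * I j)
        ≡⟨ cong (_+ sum (λ j → (i ≐ j) ⁻¹ * I j)) (trans (∑-V i) (sym (∑-select i I))) ⟩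
      sum (λ j → i ≐ j * I j) + sum (λ j → (i ≐ j) ⁻¹ * I j)
        ≡⟨ ∑-distrib-+ (λ j → i ≐ j * I j) _ ⟨
      sum (λ j → i ≐ j * I j + (i ≐ j) ⁻¹ * I j)
        ≡⟨ sum-cong-≗ (λ j → either (i ≐ j) (I j)) ⟩
      sum I ∎
      where
      either : ∀ p x → p * x + p ⁻¹ * x ≡ x
      either 0ℙ x = refl
      either 1ℙ x = ℙ.+-identityʳ x

    -- Handshake lemma: the sum of all degrees vanishes because `e i j` and `e j i` cancel, and it
    -- equals the common degree parity because k is odd.
    degree-even : ∀ i → sum (e i) ≡ 0ℙ
    degree-even i = begin
      sum (e i)                  ≡⟨ degree-const i ⟩
      sum I                      ≡⟨ cong (_* sum I) odd ⟨
      parity k * sum I           ≡⟨ ∑-const k (sum I) ⟨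
      sum {k} (λ _ → sum I)      ≡⟨ sum-cong-≗ degree-const ⟨
      sum (λ i → sum (e i))      ≡⟨ ∑∑-pairs e (λ _ _ → 0ℙ) e-diag (λ {i} {j} _ → cancel i j) ⟩
      sum {k} (λ _ → sum {k} λ _ → 0ℙ) ≡⟨ ∑-zero {k} (λ _ → sum-replicate-zero k) ⟩
      0ℙ                         ∎
      where
      cancel : ∀ i j → e i j + e j i ≡ 0ℙ
      cancel i j = trans (cong (_+ e j i) (e-sym i j)) (ℙ.p+p≡0ℙ (e j i))

  -- Inversions between pairs of rows of an orthogonal array.

  module Array {k n N : ℕ} (entry : Fin N → Fin k → Fin n)
    (cell : ∀ {c a} → c ≢ a → Fin n → Fin n → Fin N)
    (cell₁ : ∀ {c a} (c≢a : c ≢ a) x y → entry (cell c≢a x y) c ≡ x)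
    (cell₂ : ∀ {c a} (c≢a : c ≢ a) x y → entry (cell c≢a x y) a ≡ y)
    (agree : ∀ {c a} → c ≢ a → ∀ {r s} →
             entry r c ≡ entry s c → entry r a ≡ entry s a → r ≡ s)
    where

    -- Each row is the cell of its own entries in c and a, so rows can be reindexed by pairs of
    -- symbols. The proof inserts the indicators of both entries, exchanges the sums and selects the
    -- only row that fits x and y.
    ∑-cells : ∀ {c a} (c≢a : c ≢ a) (F : Fin N → Parity) →
              sum F ≡ sum λ x → sum λ y → F (cell c≢a x y)
    ∑-cells {c} {a} c≢a F = begin
      sum F
        ≡⟨ sum-cong-≗ (λ r → sym (spread r)) ⟩
      sum (λ r → sum λ x → sum λ y → entry r c ≐ x * (entry r a ≐ y * F′ x y))
        ≡⟨ ∑-comm {N} {n} _ ⟩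
      sum (λ x → sum λ r → sum λ y → entry r c ≐ x * (entry r a ≐ y * F′ x y))
        ≡⟨ sum-cong-≗ {n} (λ x → ∑-comm {N} {n} _) ⟩
      sum (λ x → sum λ y → sum λ r → entry r c ≐ x * (entry r a ≐ y * F′ x y))
        ≡⟨ sum-cong-≗ (λ x → sum-cong-≗ λ y → sum-cong-≗ (at-cell x y)) ⟩
      sum (λ x → sum λ y → sum λ r → cell c≢a x y ≐ r * F′ x y)
        ≡⟨ sum-cong-≗ (λ x → sum-cong-≗ λ y → ∑-select (cell c≢a x y) (λ _ → F′ x y)) ⟩
      sum (λ x → sum λ y → F′ x y) ∎
      where
      F′ : Fin n → Fin n → Parity
      F′ x y = F (cell c≢a x y)

      spread : ∀ r → sum (λ x → sum λ y → entry r c ≐ x * (entry r a ≐ y * F′ x y)) ≡ F r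
      spread r = begin
        sum (λ x → sum λ y → entry r c ≐ x * (entry r a ≐ y * F′ x y))
          ≡⟨ sum-cong-≗ (λ x → sym (*-distribˡ-sum (entry r c ≐ x) (λ y → entry r a ≐ y * F′ x y))) ⟩
        sum (λ x → entry r c ≐ x * sum λ y → entry r a ≐ y * F′ x y)
          ≡⟨ ∑-select (entry r c) _ ⟩
        sum (λ y → entry r a ≐ y * F′ (entry r c) y)
          ≡⟨ ∑-select (entry r a) _ ⟩
        F′ (entry r c) (entry r a)
          ≡⟨ cong F (agree c≢a (cell₁ c≢a _ _) (cell₂ c≢a _ _)) ⟩
        F r ∎

      at-cell : ∀ x y r → entry r c ≐ x * (entry r a ≐ y * F′ x y) ≡ cell c≢a x y ≐ r * F′ x y
      at-cell x y r with cell c≢a x y ≟ r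
      ... | yes refl rewrite ≐-≡ (cell₁ c≢a x y) | ≐-≡ (cell₂ c≢a x y) = refl
      ... | no cell≢r with entry r c ≟ x | entry r a ≟ y
      ...   | no _     | _        = refl
      ...   | yes _    | no _     = refl
      ...   | yes refl | yes refl = contradiction (agree c≢a (cell₁ c≢a _ _) (cell₂ c≢a _ _)) cell≢r

    -- The order in column a selects one of (r, s) and (s, r), so an unordered pair is counted at
    -- most once. In `inversion` the order of the array does this instead.
    discordance : Fin k → Fin k → Fin k → Fin N → Fin N → Parity
    discordance c a b r s = entry r c ≐ entry s c * (entry r a ⊏ entry s a * entry s b ⊏ entry r b)

    inversion : Fin k → Fin N → Fin N → Parity
    inversion a r s = r ⊏ s * entry s a ⊏ entry r a

    lineInversion : Fin k → Fin k → Fin N → Fin N → Parity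
    lineInversion c a r s = entry r c ≐ entry s c * inversion a r s

    -- The total parity of the n permutations taking column a to column b on the
    -- rows with a fixed symbol in column c.
    discord : Fin k → Fin k → Fin k → Parity
    discord c a b = sum λ r → sum λ s → discordance c a b r s

    inv : Fin k → Parity
    inv a = sum λ r → sum λ s → inversion a r s

    v : Fin k → Fin k → Parity
    v c a = sum λ r → sum λ s → lineInversion c a r s

    -- p, q, t say whether row r precedes row s in column a, in column b and in the
    -- array, so p⁻¹, q⁻¹, t⁻¹ say the same for s and r.
    inversion-sum : ∀ p q t →
      p * q ⁻¹ + p ⁻¹ * q ≡ (t * p ⁻¹ + t * q ⁻¹) + (t ⁻¹ * p + t ⁻¹ * q)
    inversion-sum 0ℙ 0ℙ 0ℙ = refl
    inversion-sum 0ℙ 0ℙ 1ℙ = refl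
    inversion-sum 0ℙ 1ℙ 0ℙ = refl
    inversion-sum 0ℙ 1ℙ 1ℙ = refl
    inversion-sum 1ℙ 0ℙ 0ℙ = refl
    inversion-sum 1ℙ 0ℙ 1ℙ = refl
    inversion-sum 1ℙ 1ℙ 0ℙ = refl
    inversion-sum 1ℙ 1ℙ 1ℙ = refl

    -- For rows that differ in both columns: the inversions in a and in b, together with the
    -- opposite orderings of a and b, cancel over the two orders of the pair.
    inversion-sum₀ : ∀ p q t →
      ((t * p ⁻¹ + t * q ⁻¹) + p * q ⁻¹) + ((t ⁻¹ * p + t ⁻¹ * q) + p ⁻¹ * q) ≡ 0ℙ
    inversion-sum₀ p q t = begin
      ((t * p ⁻¹ + t * q ⁻¹) + p * q ⁻¹) + ((t ⁻¹ * p + t ⁻¹ * q) + p ⁻¹ * q)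
        ≡⟨ interchange (t * p ⁻¹ + t * q ⁻¹) (p * q ⁻¹) (t ⁻¹ * p + t ⁻¹ * q) (p ⁻¹ * q) ⟩
      ((t * p ⁻¹ + t * q ⁻¹) + (t ⁻¹ * p + t ⁻¹ * q)) + (p * q ⁻¹ + p ⁻¹ * q)
        ≡⟨ cong (_+ (p * q ⁻¹ + p ⁻¹ * q)) (inversion-sum p q t) ⟨
      (p * q ⁻¹ + p ⁻¹ * q) + (p * q ⁻¹ + p ⁻¹ * q)
        ≡⟨ ℙ.p+p≡0ℙ (p * q ⁻¹ + p ⁻¹ * q) ⟩
      0ℙ ∎

    inversion-diag : ∀ a r → inversion a r r ≡ 0ℙ
    inversion-diag a r rewrite ⊏-irrefl r = refl

    lineInversion-diag : ∀ c a r → lineInversion c a r r ≡ 0ℙ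
    lineInversion-diag c a r rewrite ⊏-irrefl r = ℙ.*-zeroʳ (entry r c ≐ entry r c)

    -- Distinct rows that agree in c differ in a and in b. Columns a and b order them oppositely
    -- exactly when one of the two, and not both, is inverted against the order of the array.
    discord≡v+v : ∀ {c a b} → c ≢ a → c ≢ b → discord c a b ≡ v c a + v c b
    discord≡v+v {c} {a} {b} c≢a c≢b =
      trans (∑∑-pairs (discordance c a b) (λ r s → lineInversion c a r s + lineInversion c b r s) diag off)
            (∑∑-distrib-+ (lineInversion c a) (lineInversion c b))
      where
      diag : ∀ r → discordance c a b r r ≡ lineInversion c a r r + lineInversion c b r r
      diag r rewrite lineInversion-diag c a r | lineInversion-diag c b r | ⊏-irrefl (entry r a) =
        ℙ.*-zeroʳ (entry r c ≐ entry r c)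

      off : ∀ {r s} → r ≢ s →
        discordance c a b r s + discordance c a b s r ≡
        (lineInversion c a r s + lineInversion c b r s) +
        (lineInversion c a s r + lineInversion c b s r)
      off {r} {s} r≢s with entry r c ≟ entry s c
      ... | no ≢c rewrite ≐-≢ (≢c ∘ sym) = refl
      ... | yes ≡c rewrite ≐-≡ (sym ≡c)
        | ⊏-flip r≢s
        | ⊏-flip (r≢s ∘ agree c≢a ≡c)
        | ⊏-flip (r≢s ∘ agree c≢b ≡c)
        = inversion-sum (entry r a ⊏ entry s a) (entry r b ⊏ entry s b) (r ⊏ s)

    crossing : Fin k → Fin k → Fin N → Fin N → Parity
    crossing i j r s = entry r i ⊏ entry s i * entry s j ⊏ entry r j

    -- Two rows are two independent points (x, y) and (x′, y′). The conditions x < x′ and y′ < y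
    -- separate, and each is met by C(n,2) pairs of symbols.
    ∑-crossing : ∀ {i j} → i ≢ j →
      sum (λ r → sum (crossing i j r)) ≡ pairs n * pairs n
    ∑-crossing {i} {j} i≢j = begin
      sum (λ r → sum (crossing i j r))
        ≡⟨ ∑-cells i≢j _ ⟩
      sum (λ x → sum λ y → sum (crossing i j (cell i≢j x y)))
        ≡⟨ sum-cong-≗ (λ x → sum-cong-≗ λ y → row x y) ⟩
      sum {n} (λ x → sum {n} λ y → sum (x ⊏_) * sum (_⊏ y))
        ≡⟨ ∑∑-* {n} {n} (λ x → sum (x ⊏_)) (λ y → sum (_⊏ y)) ⟩
      pairs n * sum {n} (λ y → sum (_⊏ y))
        ≡⟨ cong (pairs n *_) (∑-comm {n} {n} (λ y x → x ⊏ y)) ⟩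
      pairs n * pairs n ∎
      where
      row : ∀ x y → sum (crossing i j (cell i≢j x y)) ≡ sum (x ⊏_) * sum (_⊏ y)
      row x y = begin
        sum (crossing i j (cell i≢j x y))
          ≡⟨ ∑-cells i≢j _ ⟩
        sum (λ x′ → sum λ y′ → crossing i j (cell i≢j x y) (cell i≢j x′ y′))
          ≡⟨ sum-cong-≗ (λ x′ → sum-cong-≗ λ y′ → cong₂ _*_
               (cong₂ _⊏_ (cell₁ i≢j x y) (cell₁ i≢j x′ y′))
               (cong₂ _⊏_ (cell₂ i≢j x′ y′) (cell₂ i≢j x y))) ⟩
        sum (λ x′ → sum λ y′ → x ⊏ x′ * y′ ⊏ y)
          ≡⟨ ∑∑-* {n} {n} (x ⊏_) (_⊏ y) ⟩
        sum (x ⊏_) * sum (_⊏ y) ∎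

    -- The crossings are even in number, so they may be added on the right. Then the sides agree
    -- pair by pair: rows that agree in one of the columns contribute their inversion in the other,
    -- and rows that agree in neither contribute 0 by `inversion-sum₀`.
    v-flip : ∀ {i j} → i ≢ j → pairs n ≡ 0ℙ → v i j + v j i ≡ inv i + inv j
    v-flip {i} {j} i≢j pairs≡0 = begin
      v i j + v j i
        ≡⟨ ∑∑-distrib-+ (lineInversion i j) (lineInversion j i) ⟨
      sum (λ r → sum λ s → lineInversion i j r s + lineInversion j i r s)
        ≡⟨ ∑∑-pairs _ (λ r s → (inversion i r s + inversion j r s) + crossing i j r s) diag off ⟩
      sum (λ r → sum λ s → (inversion i r s + inversion j r s) + crossing i j r s)
        ≡⟨ ∑∑-distrib-+ _ (crossing i j) ⟩
      sum (λ r → sum λ s → inversion i r s + inversion j r s) + sum (λ r → sum (crossing i j r))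
        ≡⟨ cong₂ _+_ (∑∑-distrib-+ (inversion i) (inversion j))
             (trans (∑-crossing i≢j) (cong (λ p → p * p) pairs≡0)) ⟩
      (inv i + inv j) + 0ℙ
        ≡⟨ ℙ.+-identityʳ _ ⟩
      inv i + inv j ∎
      where
      diag : ∀ r → lineInversion i j r r + lineInversion j i r r ≡
                   (inversion i r r + inversion j r r) + crossing i j r r
      diag r rewrite ⊏-irrefl r | ⊏-irrefl (entry r i)
        | ℙ.*-zeroʳ (entry r i ≐ entry r i) | ℙ.*-zeroʳ (entry r j ≐ entry r j) = refl

      off : ∀ {r s} → r ≢ s →
        (lineInversion i j r s + lineInversion j i r s) +
        (lineInversion i j s r + lineInversion j i s r) ≡
        ((inversion i r s + inversion j r s) + crossing i j r s) +
        ((inversion i s r + inversion j s r) + crossing i j s r)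
      off {r} {s} r≢s with entry r i ≟ entry s i | entry r j ≟ entry s j
      ... | yes ≡i | yes ≡j = contradiction (agree i≢j ≡i ≡j) r≢s
      ... | yes ≡i | no ≢j rewrite ≐-≡ (sym ≡i) | ≐-≢ (≢j ∘ sym) | ≡i
        | ⊏-irrefl (entry s i) | ℙ.*-zeroʳ (r ⊏ s) | ℙ.*-zeroʳ (s ⊏ r) = refl
      ... | no ≢i | yes ≡j rewrite ≐-≢ (≢i ∘ sym) | ≐-≡ (sym ≡j) | ≡j
        | ⊏-irrefl (entry s j) | ℙ.*-zeroʳ (r ⊏ s) | ℙ.*-zeroʳ (s ⊏ r)
        | ℙ.*-zeroʳ (entry r i ⊏ entry s i) | ℙ.*-zeroʳ (entry s i ⊏ entry r i)
        | ℙ.+-identityʳ (inversion i r s) | ℙ.+-identityʳ (inversion i s r)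
        -- Repeated because two zeros trail each term, one from `inversion j` and one from
        -- `crossing`.
        | ℙ.+-identityʳ (inversion i r s) | ℙ.+-identityʳ (inversion i s r) = refl
      ... | no ≢i | no ≢j rewrite ≐-≢ (≢i ∘ sym) | ≐-≢ (≢j ∘ sym)
        | ⊏-flip r≢s | ⊏-flip ≢i | ⊏-flip ≢j
        = sym (inversion-sum₀ (entry r i ⊏ entry s i) (entry r j ⊏ entry s j) (r ⊏ s))

    v-diag : ∀ i → v i i ≡ 0ℙ
    v-diag i = ∑-zero (λ r → ∑-zero (vanish r))
      where
      vanish : ∀ r s → lineInversion i i r s ≡ 0ℙ
      vanish r s with entry r i ≟ entry s i
      ... | no _ = refl
      ... | yes eq rewrite eq | ⊏-irrefl (entry s i) = ℙ.*-zeroʳ (r ⊏ s)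

    -- If r and s never agreed, then r and the rows that share column b with r and
    -- some column c ≠ b with s would be k rows with different symbols in column d.
    meet : n ℕ.< k → ∀ {b d} → b ≢ d → ∀ r s → ∃ λ c → entry r c ≡ entry s c
    meet n<k {b} {d} b≢d r s = case any? (λ c → entry r c ≟ entry s c) of λ where
        (yes found) → found
        (no ∄)      → ⊥-elim (collide (λ {c} ≡c → ∄ (c , ≡c)) (pigeonhole n<k (λ c → entry (row c) d)))
      where
      row : Fin k → Fin N
      row c = case b ≟ c of λ where
        (yes _)  → r
        (no b≢c) → cell b≢c (entry r b) (entry s c)

      row-b : ∀ c → entry (row c) b ≡ entry r b
      row-b c with b ≟ c
      ... | yes _  = refl
      ... | no b≢c = cell₁ b≢c _ _

      row-self : ∀ {c} → b ≢ c → entry (row c) c ≡ entry s c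
      row-self {c} b≢c with b ≟ c
      ... | yes b≡c = contradiction b≡c b≢c
      ... | no b≢c′ = cell₂ b≢c′ _ _

      row-base : row b ≡ r
      row-base with b ≟ b
      ... | yes _  = refl
      ... | no b≢b = contradiction refl b≢b

      collide : (∀ {c} → entry r c ≢ entry s c) →
                (∃ λ i → ∃ λ j → i < j × entry (row i) d ≡ entry (row j) d) → ⊥
      collide ∀≢ (i , j , i<j , dᵢ≡dⱼ) = case (b ≟ i) of λ where
          (yes refl) → ∀≢ (trans (cong (λ t → entry t j) (trans (sym row-base) rowᵢ≡rowⱼ))
                             (row-self (<⇒≢ i<j)))
          (no b≢i) → case (b ≟ j) of λ where
            (yes refl) → ∀≢ (trans (cong (λ t → entry t i) (trans (sym row-base) (sym rowᵢ≡rowⱼ)))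
                               (row-self b≢i))
            -- The common row agrees with s in both i and j, so it is s itself; but it shares the
            -- symbol of r in column b.
            (no b≢j) → ∀≢ (trans (sym (row-b i)) (cong (λ t → entry t b)
              (agree (<⇒≢ i<j) (row-self b≢i)
                (trans (cong (λ t → entry t j) rowᵢ≡rowⱼ) (row-self b≢j)))))
        where
        rowᵢ≡rowⱼ : row i ≡ row j
        rowᵢ≡rowⱼ = agree b≢d (trans (row-b i) (sym (row-b j))) dᵢ≡dⱼ

    -- The bridge from Latin squares to the array: P x sends the entry in a to the entry in b on the
    -- rows with x in column c, so its inversions are the discordant pairs among these rows.
    ∑-permParity : ∀ {c a b} (c≢a : c ≢ a) (P : Fin n → Permutation′ n) →
      (∀ x y → P x ⟨$⟩ʳ y ≡ entry (cell c≢a x y) b) →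
      sum (λ x → permParity (P x)) ≡ discord c a b
    ∑-permParity {c} {a} {b} c≢a P P≡ = begin
      sum (λ x → permParity (P x))
        ≡⟨ sum-cong-≗ (λ x → permParity≡∑ (P x)) ⟩
      sum (λ x → sum λ y → sum λ y′ → y ⊏ y′ * (P x ⟨$⟩ʳ y′) ⊏ (P x ⟨$⟩ʳ y))
        ≡⟨ sum-cong-≗ (λ x → sum-cong-≗ λ y → expand x y) ⟨
      sum (λ x → sum λ y → sum (discordance c a b (cell c≢a x y)))
        ≡⟨ ∑-cells c≢a (λ r → sum (discordance c a b r)) ⟨
      discord c a b ∎
      where
      expand : ∀ x y → sum (discordance c a b (cell c≢a x y)) ≡
        sum λ y′ → y ⊏ y′ * (P x ⟨$⟩ʳ y′) ⊏ (P x ⟨$⟩ʳ y)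
      expand x y = begin
        sum (discordance c a b (cell c≢a x y))
          ≡⟨ ∑-cells c≢a _ ⟩
        sum (λ x′ → sum λ y′ → discordance c a b (cell c≢a x y) (cell c≢a x′ y′))
          ≡⟨ sum-cong-≗ (λ x′ → sum-cong-≗ λ y′ → cong₂ _*_
               (cong₂ _≐_ (cell₁ c≢a x y) (cell₁ c≢a x′ y′))
               (cong₂ _*_ (cong₂ _⊏_ (cell₂ c≢a x y) (cell₂ c≢a x′ y′))
                          (cong₂ _⊏_ (sym (P≡ x′ y′)) (sym (P≡ x y))))) ⟩
        sum (λ x′ → sum λ y′ → x ≐ x′ * (y ⊏ y′ * (P x′ ⟨$⟩ʳ y′) ⊏ (P x ⟨$⟩ʳ y)))
          ≡⟨ sum-cong-≗ (λ x′ → *-distribˡ-sum (x ≐ x′) (λ y′ → y ⊏ y′ * (P x′ ⟨$⟩ʳ y′) ⊏ (P x ⟨$⟩ʳ y))) ⟨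
        sum (λ x′ → x ≐ x′ * sum λ y′ → y ⊏ y′ * (P x′ ⟨$⟩ʳ y′) ⊏ (P x ⟨$⟩ʳ y))
          ≡⟨ ∑-select x _ ⟩
        sum (λ y′ → y ⊏ y′ * (P x ⟨$⟩ʳ y′) ⊏ (P x ⟨$⟩ʳ y)) ∎

    module _ (meets : ∀ {r s} → r ≢ s → ∃ λ c → entry r c ≡ entry s c) where

      -- One common column exists by `meets`, and a second would force r = s by orthogonality.
      ∑-agreements : ∀ {r s} → r ≢ s → sum (λ c → entry r c ≐ entry s c) ≡ 1ℙ
      ∑-agreements {r} {s} r≢s with meets r≢s
      ... | c , ≡c = begin
        sum (λ d → entry r d ≐ entry s d)
          ≡⟨ sum-cong-≗ only ⟩
        sum (λ d → c ≐ d * 1ℙ)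
          ≡⟨ ∑-select c (λ _ → 1ℙ) ⟩
        1ℙ ∎
        where
        only : ∀ d → entry r d ≐ entry s d ≡ c ≐ d * 1ℙ
        only d with c ≟ d
        ... | yes refl = ≐-≡ ≡c
        ... | no c≢d   = ≐-≢ (r≢s ∘ agree c≢d ≡c)

      -- After exchanging sums, each pair inverted in b is weighted by the number of columns in
      -- which its rows agree, which is odd.
      ∑-v : ∀ b → sum (λ c → v c b) ≡ inv b
      ∑-v b = begin
        sum (λ c → sum λ r → sum λ s → lineInversion c b r s)
          ≡⟨ ∑-comm {k} {N} (λ c r → sum λ s → lineInversion c b r s) ⟩
        sum (λ r → sum λ c → sum λ s → lineInversion c b r s)
          ≡⟨ sum-cong-≗ (λ r → ∑-comm {k} {N} (λ c s → lineInversion c b r s)) ⟩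
        sum (λ r → sum λ s → sum λ c → lineInversion c b r s)
          ≡⟨ sum-cong-≗ (λ r → sum-cong-≗ λ s → collect r s) ⟩
        inv b ∎
        where
        collect : ∀ r s → sum (λ c → lineInversion c b r s) ≡ inversion b r s
        collect r s with r ≟ s
        ... | yes refl = trans (∑-zero (λ c → lineInversion-diag c b r)) (sym (inversion-diag b r))
        ... | no r≢s = begin
          sum (λ c → entry r c ≐ entry s c * inversion b r s)
            ≡⟨ *-distribʳ-sum (inversion b r s) (λ c → entry r c ≐ entry s c) ⟨
          sum (λ c → entry r c ≐ entry s c) * inversion b r s
            ≡⟨ cong (_* inversion b r s) (∑-agreements r≢s) ⟩
          inversion b r s ∎

-- Goodman's count of monochromatic triangles.

open import Data.Nat.Base using (_+_; _*_; _∸_; _≤_)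

module Triangles where
  open FiniteSums ℕ.+-*-commutativeSemiring

  2∣parity : ∀ m → parity m ≡ 0ℙ → 2 ∣ m
  2∣parity zero          _    = 2 ∣0
  2∣parity (suc (suc m)) even = ∣m∣n⇒∣m+n ∣-refl (2∣parity m even)

  ∑-∣ : ∀ {d n} (f : Fin n → ℕ) → (∀ i → d ∣ f i) → d ∣ sum f
  ∑-∣ {n = zero}  f d∣f = _ ∣0
  ∑-∣ {n = suc n} f d∣f = ∣m∣n⇒∣m+n (d∣f zero) (∑-∣ (f ∘ suc) (d∣f ∘ suc))

  ∑-≤ : ∀ {n} (f : Fin n → ℕ) {m} → (∀ i → f i ≤ m) → sum f ≤ n * m
  ∑-≤ {zero}  f f≤m = z≤n
  ∑-≤ {suc n} f f≤m = ℕ.+-mono-≤ (f≤m zero) (∑-≤ (f ∘ suc) (f≤m ∘ suc))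

  ∑-const : ∀ n m → sum {n} (λ _ → m) ≡ n * m
  ∑-const zero    m = refl
  ∑-const (suc n) m = cong (m +_) (∑-const n m)

  -- The sides differ by the square of the gap t between x and y.
  4xy≤[x+y]² : ∀ x y → 4 * (x * y) ≤ (x + y) * (x + y)
  4xy≤[x+y]² x y with ℕ.≤-total x y
  ... | inj₁ x≤y with ℕ.m≤n⇒∃[o]m+o≡n x≤y
  ...   | t , refl = subst (4 * (x * (x + t)) ≤_) (square x t) (ℕ.m≤m+n _ (t * t))
    where
    square : ∀ x t → 4 * (x * (x + t)) + t * t ≡ (x + (x + t)) * (x + (x + t))
    square = solve-∀
  4xy≤[x+y]² x y | inj₂ y≤x with ℕ.m≤n⇒∃[o]m+o≡n y≤x
  ...   | t , refl = subst (4 * ((y + t) * y) ≤_) (square y t) (ℕ.m≤m+n _ (t * t))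
    where
    square : ∀ y t → 4 * ((y + t) * y) + t * t ≡ ((y + t) + y) * ((y + t) + y)
    square = solve-∀

  ∑³ : ∀ {k} → (Fin k → Fin k → Fin k → ℕ) → ℕ
  ∑³ F = sum λ i → sum λ j → sum λ l → F i j l

  ∑³-cong : ∀ {k} {F G : Fin k → Fin k → Fin k → ℕ} →
            (∀ i j l → F i j l ≡ G i j l) → ∑³ F ≡ ∑³ G
  ∑³-cong F≡G = sum-cong-≗ λ i → sum-cong-≗ λ j → sum-cong-≗ (F≡G i j)

  ∑³-+ : ∀ {k} (F G : Fin k → Fin k → Fin k → ℕ) →
         ∑³ (λ i j l → F i j l + G i j l) ≡ ∑³ F + ∑³ G
  ∑³-+ F G = trans (sum-cong-≗ (λ i → ∑∑-distrib-+ (F i) (G i)))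
                   (∑-distrib-+ (λ i → sum λ j → sum (F i j)) (λ i → sum λ j → sum (G i j)))

  ∑³-* : ∀ {k} c (F : Fin k → Fin k → Fin k → ℕ) → ∑³ (λ i j l → c * F i j l) ≡ c * ∑³ F
  ∑³-* c F = sym (trans (*-distribˡ-sum c (λ i → sum λ j → sum (F i j))) (sum-cong-≗ λ i →
             trans (*-distribˡ-sum c (λ j → sum (F i j))) (sum-cong-≗ λ j → *-distribˡ-sum c (F i j))))

  ∑³-swap₁₂ : ∀ {k} (F : Fin k → Fin k → Fin k → ℕ) → ∑³ (λ i j l → F j i l) ≡ ∑³ F
  ∑³-swap₁₂ {k} F = ∑-comm {k} {k} (λ i j → sum (F j i))

  ∑³-swap₂₃ : ∀ {k} (F : Fin k → Fin k → Fin k → ℕ) → ∑³ (λ i j l → F i l j) ≡ ∑³ F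
  ∑³-swap₂₃ {k} F = sum-cong-≗ λ i → ∑-comm {k} {k} (λ j l → F i l j)

  -- Identities that hold only over all orders of a triple become pointwise after symmetrising; the
  -- total merely gains a factor 6, cancelled later.
  symmetrise : ∀ {k} → (Fin k → Fin k → Fin k → ℕ) → Fin k → Fin k → Fin k → ℕ
  symmetrise F i j l =
    F i j l + (F i l j + (F j i l + (F j l i + (F l i j + F l j i))))

  ∑³-symmetrise : ∀ {k} (F : Fin k → Fin k → Fin k → ℕ) → ∑³ (symmetrise F) ≡ 6 * ∑³ F
  ∑³-symmetrise {k} F = begin
    ∑³ (symmetrise F)
      ≡⟨ trans (∑³-+ F₁ _) (cong (∑³ F₁ +_) (trans (∑³-+ F₂ _) (cong (∑³ F₂ +_)
         (trans (∑³-+ F₃ _) (cong (∑³ F₃ +_) (trans (∑³-+ F₄ _) (cong (∑³ F₄ +_) (∑³-+ F₅ F₆)))))))) ⟩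
    ∑³ F₁ + (∑³ F₂ + (∑³ F₃ + (∑³ F₄ + (∑³ F₅ + ∑³ F₆))))
      ≡⟨ cong (∑³ F₁ +_) (cong₂ _+_ F₂≡ (cong₂ _+_ F₃≡ (cong₂ _+_ F₄≡ (cong₂ _+_ F₅≡ F₆≡)))) ⟩
    ∑³ F + (∑³ F + (∑³ F + (∑³ F + (∑³ F + ∑³ F))))
      ≡⟨ six (∑³ F) ⟩
    6 * ∑³ F ∎
    where
    open ≡-Reasoning
    F₁ F₂ F₃ F₄ F₅ F₆ : Fin k → Fin k → Fin k → ℕ
    F₁ = F
    F₂ i j l = F i l j
    F₃ i j l = F j i l
    F₄ i j l = F j l i
    F₅ i j l = F l i j
    F₆ i j l = F l j i
    F₂≡ = ∑³-swap₂₃ F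
    F₃≡ = ∑³-swap₁₂ F
    F₄≡ = trans (∑³-swap₁₂ F₂) F₂≡
    F₅≡ = trans (∑³-swap₂₃ F₃) F₃≡
    F₆≡ = trans (∑³-swap₂₃ F₄) F₄≡
    six : ∀ x → x + (x + (x + (x + (x + x)))) ≡ 6 * x
    six = solve-∀

  ordered : ∀ {k} → Fin k → Fin k → Fin k → ℕ
  ordered i j l = 𝟙 (does (i <? j)) * 𝟙 (does (j <? l))

  symmetrise-ordered : ∀ {k} {i j l : Fin k} → i ≢ j → i ≢ l → j ≢ l → symmetrise ordered i j l ≡ 1
  symmetrise-ordered {i = i} {j} {l} i≢j i≢l j≢l
    rewrite <?-flip i≢j | <?-flip i≢l | <?-flip j≢l =
    one (does (i <? j)) (does (i <? l)) (does (j <? l)) transitive cotransitive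
    where
    witness : ∀ {P : Set} (P? : Dec P) → does P? ≡ true → P
    witness (yes p) _ = p

    refutation : ∀ {P : Set} (P? : Dec P) → does P? ≡ false → ¬ P
    refutation (no ¬p) _ = ¬p

    transitive : does (i <? j) ≡ true → does (j <? l) ≡ true → does (i <? l) ≡ true
    transitive p r = dec-true (i <? l) (<-trans (witness (i <? j) p) (witness (j <? l) r))

    cotransitive : does (i <? j) ≡ false → does (j <? l) ≡ false → does (i <? l) ≡ false
    cotransitive p r = dec-false (i <? l) (ℕ.≤⇒≯ (ℕ.≤-trans
      (ℕ.≮⇒≥ (refutation (j <? l) r)) (ℕ.≮⇒≥ (refutation (i <? j) p))))

    one : ∀ p q r → (p ≡ true → r ≡ true → q ≡ true) → (p ≡ false → r ≡ false → q ≡ false) →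
      𝟙 p * 𝟙 r + (𝟙 q * 𝟙 (not r) + (𝟙 (not p) * 𝟙 q + (𝟙 r * 𝟙 (not q) +
      (𝟙 (not q) * 𝟙 p + 𝟙 (not r) * 𝟙 (not p))))) ≡ 1
    one true  true  true  _ _ = refl
    one true  true  false _ _ = refl
    one true  false false _ _ = refl
    one false true  true  _ _ = refl
    one false false true  _ _ = refl
    one false false false _ _ = refl
    -- The last two patterns are cyclic, i < j < l < i and its reverse, and transitivity excludes
    -- them.
    one true  false true  t _ = case t refl refl of λ ()
    one false true  false _ c = case c refl refl of λ ()

  -- `nothing` is the absent loop, `just 1ℙ` an edge of the graph and `just 0ℙ` an edge of its
  -- complement.
  red blue edge : Maybe Parity → ℕ
  red (just 1ℙ) = 1
  red _         = 0
  blue (just 0ℙ) = 1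
  blue _         = 0
  edge (just _) = 1
  edge nothing  = 0

  mono : (x y z : Maybe Parity) → ℕ
  mono x y z = red x * red y * red z + blue x * blue y * blue z

  mono-swap₁₂ : ∀ x y z → mono y x z ≡ mono x y z
  mono-swap₁₂ x y z = cong₂ (λ r b → r * red z + b * blue z)
    (ℕ.*-comm (red y) (red x)) (ℕ.*-comm (blue y) (blue x))

  mono-swap₂₃ : ∀ x y z → mono x z y ≡ mono x y z
  mono-swap₂₃ x y z = cong₂ _+_ (swap (red x) (red z) (red y)) (swap (blue x) (blue z) (blue y))
    where
    swap : ∀ a b c → a * b * c ≡ a * c * b
    swap = solve-∀

  module Coloured {k : ℕ} (colour : Fin k → Fin k → Maybe Parity)
    (colour-diag : ∀ i → colour i i ≡ nothing)
    (colour-≢ : ∀ {i j} → i ≢ j → ∃ λ p → colour i j ≡ just p)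
    (colour-sym : ∀ i j → colour i j ≡ colour j i)
    where

    triangle monochromatic cherry : Fin k → Fin k → Fin k → ℕ
    triangle i j l      = edge (colour i j) * edge (colour i l) * edge (colour j l)
    monochromatic i j l = mono (colour i j) (colour i l) (colour j l)
    cherry i j l        = red (colour i j) * blue (colour i l)

    monoTriples : ℕ
    monoTriples = ∑³ λ i j l → ordered i j l * monochromatic i j l

    -- Being monochromatic does not depend on the order of the vertices, and exactly one order of
    -- distinct vertices is increasing. With a repeated vertex the missing loop makes both sides 0.
    symmetrise-ordered-mono : ∀ i j l →
      symmetrise (λ i j l → ordered i j l * monochromatic i j l) i j l ≡ monochromatic i j l
    symmetrise-ordered-mono i j l
      rewrite colour-sym j i | colour-sym l i | colour-sym l j = begin
      ordered i j l * mono x y z + (ordered i l j * mono y x z + (ordered j i l * mono x z y +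
      (ordered j l i * mono z x y + (ordered l i j * mono y z x + ordered l j i * mono z y x))))
        ≡⟨ cong (ordered i j l * m +_)
           (cong₂ _+_ (cong (ordered i l j *_) yxz) (cong₂ _+_ (cong (ordered j i l *_) xzy)
           (cong₂ _+_ (cong (ordered j l i *_) zxy) (cong₂ _+_ (cong (ordered l i j *_) yzx)
           (cong (ordered l j i *_) zyx))))) ⟩
      ordered i j l * m + (ordered i l j * m + (ordered j i l * m +
      (ordered j l i * m + (ordered l i j * m + ordered l j i * m))))
        ≡⟨ factor (ordered i j l) (ordered i l j) (ordered j i l) (ordered j l i) (ordered l i j) (ordered l j i) m ⟩
      symmetrise ordered i j l * m
        ≡⟨ absorb ⟩
      m ∎
      where
      open ≡-Reasoning
      x = colour i j
      y = colour i l
      z = colour j l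
      m = mono x y z
      yxz : mono y x z ≡ m
      yxz = mono-swap₁₂ x y z
      xzy : mono x z y ≡ m
      xzy = mono-swap₂₃ x y z
      zxy : mono z x y ≡ m
      zxy = trans (mono-swap₁₂ x z y) xzy
      yzx : mono y z x ≡ m
      yzx = trans (mono-swap₂₃ y x z) yxz
      zyx : mono z y x ≡ m
      zyx = trans (mono-swap₂₃ z x y) zxy

      factor : ∀ a b c d f g m →
        a * m + (b * m + (c * m + (d * m + (f * m + g * m)))) ≡ (a + (b + (c + (d + (f + g))))) * m
      factor = solve-∀

      vanish : m ≡ 0 → symmetrise ordered i j l * m ≡ m
      vanish m≡0 = trans (cong (symmetrise ordered i j l *_) m≡0)
                   (trans (ℕ.*-zeroʳ (symmetrise ordered i j l)) (sym m≡0))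

      absorb : symmetrise ordered i j l * m ≡ m
      absorb with i ≟ j | i ≟ l | j ≟ l
      ... | yes refl | _ | _ = vanish (cong (λ c → mono c y z) (colour-diag i))
      ... | no _ | yes refl | _ = vanish (trans (sym yxz) (cong (λ c → mono c x z) (colour-diag i)))
      ... | no _ | no _ | yes refl = vanish (trans (sym zxy) (cong (λ c → mono c x y) (colour-diag j)))
      ... | no i≢j | no i≢l | no j≢l =
        trans (cong (_* m) (symmetrise-ordered i≢j i≢l j≢l)) (ℕ.*-identityˡ m)

    -- A triangle that is not monochromatic has exactly two vertices where its
    -- colours change.
    balance : ∀ i j l →
      symmetrise triangle i j l ≡ 6 * monochromatic i j l + 3 * symmetrise cherry i j l
    balance i j l with i ≟ j
    -- With a repeated index every product contains a loop or has the form `red c * blue c`, so both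
    -- sides vanish.
    balance i i l | yes refl rewrite colour-diag i | colour-sym l i with colour i l
    ... | nothing   = refl
    ... | just 0ℙ   = refl
    ... | just 1ℙ   = refl
    balance i j l | no i≢j with i ≟ l
    balance i j i | no i≢j | yes refl rewrite colour-diag i | colour-sym j i with colour i j
    ... | nothing   = refl
    ... | just 0ℙ   = refl
    ... | just 1ℙ   = refl
    balance i j l | no i≢j | no i≢l with j ≟ l
    balance i j j | no i≢j | no i≢l | yes refl rewrite colour-diag j | colour-sym j i with colour i j
    ... | nothing   = refl
    ... | just 0ℙ   = refl
    ... | just 1ℙ   = refl
    balance i j l | no i≢j | no i≢l | no j≢l
      rewrite colour-sym j i | colour-sym l i | colour-sym l j
      with colour-≢ i≢j | colour-≢ i≢l | colour-≢ j≢l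
    ... | p , p≡ | q , q≡ | r , r≡ rewrite p≡ | q≡ | r≡ = balanced p q r
      where
      T : (x y z : Maybe Parity) → ℕ
      T x y z = edge x * edge y * edge z
      balanced : ∀ p q r → let x = just p; y = just q; z = just r in
        T x y z + (T y x z + (T x z y + (T z x y + (T y z x + T z y x)))) ≡
        6 * mono x y z + 3 * (red x * blue y + (red y * blue x + (red x * blue z +
          (red z * blue x + (red y * blue z + red z * blue y)))))
      balanced 0ℙ 0ℙ 0ℙ = refl
      balanced 0ℙ 0ℙ 1ℙ = refl
      balanced 0ℙ 1ℙ 0ℙ = refl
      balanced 0ℙ 1ℙ 1ℙ = refl
      balanced 1ℙ 0ℙ 0ℙ = refl
      balanced 1ℙ 0ℙ 1ℙ = refl
      balanced 1ℙ 1ℙ 0ℙ = refl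
      balanced 1ℙ 1ℙ 1ℙ = refl

    reds blues : Fin k → ℕ
    reds i = sum λ j → red (colour i j)
    blues i = sum λ j → blue (colour i j)

    -- The sum of d_i (n - d_i) in Goodman's formula.
    cherries : ℕ
    cherries = sum λ i → reds i * blues i

    ∑-cherry : ∑³ cherry ≡ cherries
    ∑-cherry = sum-cong-≗ λ i → ∑∑-* (λ j → red (colour i j)) (λ l → blue (colour i l))

    module _ {n : ℕ} (k≡1+n : k ≡ suc n) where
      open ≡-Reasoning

      ∑-edge : ∀ i → sum (λ j → edge (colour i j)) ≡ n
      ∑-edge i = ℕ.+-cancelʳ-≡ 1 _ _ (begin
        sum (λ j → edge (colour i j)) + 1
          ≡⟨ cong (sum (λ j → edge (colour i j)) +_) (∑-select i (λ _ → 1)) ⟨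
        sum (λ j → edge (colour i j)) + sum (λ j → 𝟙 (does (i ≟ j)) * 1)
          ≡⟨ ∑-distrib-+ (λ j → edge (colour i j)) _ ⟨
        sum (λ j → edge (colour i j) + 𝟙 (does (i ≟ j)) * 1)
          ≡⟨ sum-cong-≗ complete ⟩
        sum {k} (λ _ → 1)
          ≡⟨ ∑-const k 1 ⟩
        k * 1
          ≡⟨ ℕ.*-identityʳ k ⟩
        k
          ≡⟨ k≡1+n ⟩
        suc n
          ≡⟨ ℕ.+-comm n 1 ⟨
        n + 1 ∎)
        where
        complete : ∀ j → edge (colour i j) + 𝟙 (does (i ≟ j)) * 1 ≡ 1
        complete j with i ≟ j
        ... | yes refl = cong (λ c → edge c + 1) (colour-diag i)
        ... | no i≢j   = cong (λ c → edge c + 0) (proj₂ (colour-≢ i≢j))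

      reds+blues : ∀ i → reds i + blues i ≡ n
      reds+blues i = begin
        reds i + blues i
          ≡⟨ ∑-distrib-+ (λ j → red (colour i j)) (λ j → blue (colour i j)) ⟨
        sum (λ j → red (colour i j) + blue (colour i j))
          ≡⟨ sum-cong-≗ (λ j → red+blue (colour i j)) ⟩
        sum (λ j → edge (colour i j))
          ≡⟨ ∑-edge i ⟩
        n ∎
        where
        red+blue : ∀ c → red c + blue c ≡ edge c
        red+blue nothing   = refl
        red+blue (just 0ℙ) = refl
        red+blue (just 1ℙ) = refl

      -- Among the n² ordered pairs of edges at a vertex, n repeat an edge and the others span a
      -- triangle. The repetitions stand on the left to avoid subtraction.
      ∑-triangle : ∑³ triangle + k * n ≡ k * (n * n)
      ∑-triangle = begin
        ∑³ triangle + k * n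
          ≡⟨ cong (∑³ triangle +_) degenerate ⟨
        ∑³ triangle + ∑³ (λ i j l → 𝟙 (does (j ≟ l)) * (E i j * E i l))
          ≡⟨ ∑³-+ triangle _ ⟨
        ∑³ (λ i j l → triangle i j l + 𝟙 (does (j ≟ l)) * (E i j * E i l))
          ≡⟨ ∑³-cong (λ i j l → split i j l (j ≟ l)) ⟩
        ∑³ (λ i j l → E i j * E i l)
          ≡⟨ sum-cong-≗ (λ i → ∑∑-* (E i) (E i)) ⟩
        sum (λ i → sum (E i) * sum (E i))
          ≡⟨ sum-cong-≗ (λ i → cong₂ _*_ (∑-edge i) (∑-edge i)) ⟩
        sum {k} (λ _ → n * n)
          ≡⟨ ∑-const k (n * n) ⟩
        k * (n * n) ∎
        where
        E : Fin k → Fin k → ℕ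
        E i j = edge (colour i j)

        degenerate : ∑³ (λ i j l → 𝟙 (does (j ≟ l)) * (E i j * E i l)) ≡ k * n
        degenerate = begin
          ∑³ (λ i j l → 𝟙 (does (j ≟ l)) * (E i j * E i l))
            ≡⟨ sum-cong-≗ (λ i → sum-cong-≗ λ j → ∑-select j (λ l → E i j * E i l)) ⟩
          sum (λ i → sum λ j → E i j * E i j)
            ≡⟨ sum-cong-≗ (λ i → sum-cong-≗ λ j → idem (colour i j)) ⟩
          sum (λ i → sum (E i))
            ≡⟨ sum-cong-≗ ∑-edge ⟩
          sum {k} (λ _ → n)
            ≡⟨ ∑-const k n ⟩
          k * n ∎
          where
          idem : ∀ c → edge c * edge c ≡ edge c
          idem nothing  = refl
          idem (just _) = refl

        split : ∀ i j l (j≟l : Dec (j ≡ l)) →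
          triangle i j l + 𝟙 (does j≟l) * (E i j * E i l) ≡ E i j * E i l
        split i j l (yes refl) rewrite colour-diag j | ℕ.*-zeroʳ (E i j * E i j) = ℕ.*-identityˡ (E i j * E i j)
        split i j l (no j≢l) rewrite proj₂ (colour-≢ j≢l) =
          trans (ℕ.+-identityʳ _) (ℕ.*-identityʳ (E i j * E i l))

      -- Goodman's identity without subtraction: `balance` is summed over all triples, and the
      -- factor 6 from symmetrising is cancelled.
      count : 6 * monoTriples + 3 * cherries + k * n ≡ k * (n * n)
      count = trans (cong (_+ k * n) (sym triangles)) ∑-triangle
        where
        triangles : ∑³ triangle ≡ 6 * monoTriples + 3 * cherries
        triangles = ℕ.*-cancelˡ-≡ _ _ 6 (begin
          6 * ∑³ triangle
            ≡⟨ ∑³-symmetrise triangle ⟨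
          ∑³ (symmetrise triangle)
            ≡⟨ ∑³-cong balance ⟩
          ∑³ (λ i j l → 6 * monochromatic i j l + 3 * symmetrise cherry i j l)
            ≡⟨ ∑³-+ (λ i j l → 6 * monochromatic i j l) _ ⟩
          ∑³ (λ i j l → 6 * monochromatic i j l) + ∑³ (λ i j l → 3 * symmetrise cherry i j l)
            ≡⟨ cong₂ _+_ (∑³-* 6 monochromatic) (∑³-* 3 (symmetrise cherry)) ⟩
          6 * ∑³ monochromatic + 3 * ∑³ (symmetrise cherry)
            ≡⟨ cong₂ (λ a b → 6 * a + 3 * b)
                 (trans (sym (∑³-cong symmetrise-ordered-mono))
                        (∑³-symmetrise (λ i j l → ordered i j l * monochromatic i j l)))
                 (trans (∑³-symmetrise cherry) (cong (6 *_) ∑-cherry)) ⟩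
          6 * (6 * monoTriples) + 3 * (6 * cherries)
            ≡⟨ regroup monoTriples cherries ⟩
          6 * (6 * monoTriples + 3 * cherries) ∎)
          where
          regroup : ∀ a b → 6 * (6 * a) + 3 * (6 * b) ≡ 6 * (6 * a + 3 * b)
          regroup = solve-∀

    module _ {n : ℕ} (k≡1+n : k ≡ suc n) where
      open ℕ.≤-Reasoning

      -- With C triangles and S cherries, four times `count` gives 24 C = 4kn² - 4kn - 12 S, and 4 S
      -- ≤ kn² leaves at least kn² - 4kn. Adding 12 S to both sides keeps the argument within the
      -- natural numbers.
      lower-bound : n * (n + 1) * (n ∸ 4) ≤ 24 * monoTriples
      lower-bound = subst (_≤ 24 * monoTriples) (sym (ℕ.*-distribˡ-∸ (n * (n + 1)) n 4))
        (ℕ.m≤n+o⇒m∸n≤o (n * (n + 1) * n) (n * (n + 1) * 4) (ℕ.+-cancelˡ-≤ (12 * S) _ _ bound))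
        where
        S = cherries
        C = monoTriples

        4S≤ : 4 * S ≤ k * (n * n)
        4S≤ = subst (_≤ k * (n * n)) (sym (*-distribˡ-sum 4 (λ i → reds i * blues i)))
          (∑-≤ _ λ i → subst (λ m → 4 * (reds i * blues i) ≤ m * m) (reds+blues k≡1+n i) (4xy≤[x+y]² (reds i) (blues i)))

        bound : 12 * S + n * (n + 1) * n ≤ 12 * S + (n * (n + 1) * 4 + 24 * C)
        bound = begin
          12 * S + n * (n + 1) * n
            ≡⟨ cong₂ _+_ (ℕ.*-assoc 3 4 S) (cong (_* n) (trans (cong (n *_) (trans (ℕ.+-comm n 1) (sym k≡1+n))) (ℕ.*-comm n k))) ⟩
          3 * (4 * S) + k * n * n
            ≤⟨ ℕ.+-monoˡ-≤ (k * n * n) (ℕ.*-monoʳ-≤ 3 4S≤) ⟩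
          3 * (k * (n * n)) + k * n * n
            ≡⟨ cong (3 * (k * (n * n)) +_) (ℕ.*-assoc k n n) ⟩
          3 * (k * (n * n)) + k * (n * n)
            ≡⟨ cong (λ t → 3 * t + t) (sym (count k≡1+n)) ⟩
          3 * (6 * C + 3 * S + k * n) + (6 * C + 3 * S + k * n)
            ≡⟨ cong (λ t → 3 * (6 * C + 3 * S + t * n) + (6 * C + 3 * S + t * n)) (trans k≡1+n (ℕ.+-comm 1 n)) ⟩
          3 * (6 * C + 3 * S + (n + 1) * n) + (6 * C + 3 * S + (n + 1) * n)
            ≡⟨ collect C S n ⟩
          12 * S + (n * (n + 1) * 4 + 24 * C) ∎
          where
          collect : ∀ c s n →
            3 * (6 * c + 3 * s + (n + 1) * n) + (6 * c + 3 * s + (n + 1) * n) ≡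
            12 * s + (n * (n + 1) * 4 + 24 * c)
          collect = solve-∀

      -- Red and blue degrees are both even, so 4 divides S. It also divides the terms with factor n
      -- in `count`, hence 6 C; so 3 C is even, and with it C.
      even : 4 ∣ n → (∀ i → 2 ∣ reds i) → 2 ∣ monoTriples
      even 4∣n 2∣reds = ∣m+n∣m⇒∣n (subst (2 ∣_) (thrice monoTriples) (*-cancelˡ-∣ 2 4∣6C)) (m∣m*n monoTriples)
        where
        S = cherries
        thrice : ∀ c → 3 * c ≡ 2 * c + c
        thrice = solve-∀

        2∣blues : ∀ i → 2 ∣ blues i
        2∣blues i = ∣m+n∣m⇒∣n (subst (2 ∣_) (sym (reds+blues k≡1+n i)) (∣-trans (divides 2 refl) 4∣n)) (2∣reds i)

        4∣S : 4 ∣ S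
        4∣S = ∑-∣ _ λ i → *-pres-∣ (2∣reds i) (2∣blues i)

        4∣6C : 2 * 2 ∣ 2 * (3 * monoTriples)
        4∣6C = subst (4 ∣_) (ℕ.*-assoc 2 3 monoTriples) (∣m+n∣m⇒∣n
          (subst (4 ∣_) (trans (sym (count k≡1+n)) (rotate (6 * monoTriples) (3 * S) (k * n)))
            (∣n⇒∣m*n k (∣n⇒∣m*n n 4∣n)))
          (∣m∣n⇒∣m+n (∣n⇒∣m*n 3 4∣S) (∣n⇒∣m*n k 4∣n)))
          where
          rotate : ∀ a b c → a + b + c ≡ b + c + a
          rotate = solve-∀

-- From complete orthogonal arrays to coloured complete graphs.

module CompleteArray {n : ℕ} (2≤n : 2 ≤ n) (4∣n : 4 ∣ n) {Λ : Set} (enum : Λ ↔ Fin n)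
  (A : OrthogonalArray (suc n) n Λ) where
  open OrthogonalArray A
  open Inverse enum using (to; from; strictlyInverseˡ; strictlyInverseʳ)
  open Parities hiding (module Array; module Graph)

  array-agree : ∀ {c a} → c ≢ a → ∀ {r s} →
                array r c ≡ array s c → array r a ≡ array s a → r ≡ s
  array-agree c≢a {s = s} ≡c ≡a = trans (sym (unique (≡c , ≡a))) (unique (refl , refl))
    where unique = λ {r} → proj₂ (proj₂ (orthogonal c≢a (array s _) (array s _))) {r}

  theRow₁ : ∀ {c a} (c≢a : c ≢ a) x y → array (theRow c≢a x y) c ≡ x
  theRow₁ c≢a x y = proj₁ (proj₁ (proj₂ (orthogonal c≢a x y)))

  theRow₂ : ∀ {c a} (c≢a : c ≢ a) x y → array (theRow c≢a x y) a ≡ y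
  theRow₂ c≢a x y = proj₂ (proj₁ (proj₂ (orthogonal c≢a x y)))

  -- Column and symbol permutations fix the symbol of the second column used in the lookup, while
  -- `∑-permParity` wants the fixed column first.
  theRow-swap : ∀ {c a} (c≢a : c ≢ a) (a≢c : a ≢ c) x y → theRow c≢a x y ≡ theRow a≢c y x
  theRow-swap c≢a a≢c x y = array-agree c≢a
    (trans (theRow₁ c≢a x y) (sym (theRow₂ a≢c y x)))
    (trans (theRow₂ c≢a x y) (sym (theRow₁ a≢c y x)))

  to-injective : ∀ {x y} → to x ≡ to y → x ≡ y
  to-injective {x} {y} eq =
    trans (sym (strictlyInverseʳ x)) (trans (cong from eq) (strictlyInverseʳ y))

  -- Symbols are carried to `Fin n`, whose order defines inversions.
  open Parities.Array (λ r c → to (array r c)) (λ c≢a x y → theRow c≢a (from x) (from y))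
    (λ c≢a x y → trans (cong to (theRow₁ c≢a _ _)) (strictlyInverseˡ x))
    (λ c≢a x y → trans (cong to (theRow₂ c≢a _ _)) (strictlyInverseˡ y))
    (λ c≢a ≡c ≡a → array-agree c≢a (to-injective ≡c) (to-injective ≡a))

  odd-columns : parity (suc n) ≡ 1ℙ
  odd-columns = ℙ.⁻¹-injective (trans (ℙ.suc-homo-⁻¹ n) (parity-4∣ 4∣n))
    where
    parity-4∣ : ∀ {m} → 4 ∣ m → parity m ≡ 0ℙ
    parity-4∣ (divides q refl) = trans (ℙ.*-homo-* q 4) (ℙ.*-zeroʳ (parity q))

  two-columns : ∃ λ b → ∃ λ d → b ≢ d
  two-columns = distinct 2≤n
    where
    distinct : ∀ {m} → 2 ≤ m → ∃ λ (b : Fin (suc m)) → ∃ λ d → b ≢ d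
    distinct (s≤s _) = zero , suc zero , λ ()

  -- Any two rows meet because there are n + 1 columns and only n symbols.
  open Parities.Graph odd-columns v inv v-diag (λ i≢j → v-flip i≢j (pairs-4∣ 4∣n))
    (∑-v (λ {r} {s} _ → meet (ℕ.n<1+n n) (proj₂ (proj₂ two-columns)) r s))

  -- On the diagonal e is 0 and would count as blue, so loops are removed explicitly.
  colour : Fin (suc n) → Fin (suc n) → Maybe Parity
  colour i j = if does (i ≟ j) then nothing else just (e i j)

  colour-diag : ∀ i → colour i i ≡ nothing
  colour-diag i = cong (if_then nothing else just (e i i)) (dec-true (i ≟ i) refl)

  colour-≢ : ∀ {i j} → i ≢ j → colour i j ≡ just (e i j)
  colour-≢ {i} {j} i≢j = cong (if_then nothing else just (e i j)) (dec-false (i ≟ j) i≢j)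

  colour-sym : ∀ i j → colour i j ≡ colour j i
  colour-sym i j = case i ≟ j of λ where
    (yes i≡j) → cong₂ colour i≡j (sym i≡j)
    (no i≢j)  → trans (colour-≢ i≢j) (trans (cong just (e-sym i j)) (sym (colour-≢ (i≢j ∘ sym))))

  open Triangles hiding (module Coloured)
  open Triangles.Coloured colour colour-diag (λ i≢j → _ , colour-≢ i≢j) colour-sym

  2∣reds : ∀ i → 2 ∣ reds i
  2∣reds i = 2∣parity (reds i) (trans (parity-∑ (λ j → red (colour i j)))
    (trans (sum-cong-≗ parity-red) (degree-even i)))
    where
    parity-bit : ∀ p → parity (red (just p)) ≡ p
    parity-bit 0ℙ = refl
    parity-bit 1ℙ = refl

    parity-red : ∀ j → parity (red (colour i j)) ≡ e i j
    parity-red j = case i ≟ j of λ where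
      (yes refl) → trans (cong (parity ∘ red) (colour-diag i)) (sym (e-diag i))
      (no i≢j)   → trans (cong (parity ∘ red) (colour-≢ i≢j)) (parity-bit (e i j))

  module _ {i j l : Fin (suc n)} (i≢j : i ≢ j) (i≢l : i ≢ l) (j≢l : j ≢ l) where

    L : LatinSquare Λ
    L = latinSquare i≢j i≢l j≢l
    open LatinSquare L

    transport : Λ ↔ Λ → Permutation′ n
    transport σ = enum ↔-∘ (σ ↔-∘ ↔-sym enum)

    -- Row permutations take column j to column l along a fixed symbol of i, so their parity
    -- compares the two edges at vertex i. Column and symbol permutations likewise belong to the
    -- vertices j and l.
    rowParity-L : rowParity enum L ≡ e i j ℙ.+ e i l
    rowParity-L =
      trans (∑-permParity i≢j (λ x → transport (rowPerm (from x))) (λ x y → refl))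
      (trans (discord≡v+v i≢j i≢l) (V+V≡e+e i≢j i≢l))

    colParity-L : colParity enum L ≡ e i j ℙ.+ e j l
    colParity-L =
      trans (∑-permParity j≢i (λ y → transport (colPerm (from y)))
        (λ y x → cong (λ r → to (array r l)) (theRow-swap i≢j j≢i (from x) (from y))))
      (trans (discord≡v+v j≢i j≢l) (trans (V+V≡e+e j≢i j≢l) (cong (ℙ._+ e j l) (e-sym j i))))
      where j≢i = i≢j ∘ sym

    symParity-L : symParity enum L ≡ e i l ℙ.+ e j l
    symParity-L =
      trans (∑-permParity l≢i (λ s → transport (symPerm (from s)))
        (λ s x → cong (λ r → to (array r j)) (theRow-swap i≢l l≢i (from x) (from s))))
      (trans (discord≡v+v l≢i l≢j) (trans (V+V≡e+e l≢i l≢j) (cong₂ ℙ._+_ (e-sym l i) (e-sym l j))))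
      where
      l≢i = i≢l ∘ sym
      l≢j = j≢l ∘ sym

    -- Any two of the three parities share one edge, so they are equal exactly when the other two
    -- edges have the same colour.
    equiparity-mono : ℕ∑.𝟙 (does (equiparity? enum L)) ≡ monochromatic i j l
    equiparity-mono = trans
      (cong₂ (λ p q → ℕ∑.𝟙 (p ∧ q))
        (cong₂ (λ p q → does (p ℙ.≟ q)) rowParity-L colParity-L)
        (cong₂ (λ p q → does (p ℙ.≟ q)) colParity-L symParity-L))
      (trans (all-equal (e i j) (e i l) (e j l))
        (sym (trans (cong (λ c → mono c (colour i l) (colour j l)) (colour-≢ i≢j))
          (cong₂ (mono (just (e i j))) (colour-≢ i≢l) (colour-≢ j≢l)))))
      where
      all-equal : ∀ x y z →
        ℕ∑.𝟙 (does ((x ℙ.+ y) ℙ.≟ (x ℙ.+ z)) ∧ does ((x ℙ.+ z) ℙ.≟ (y ℙ.+ z))) ≡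
        mono (just x) (just y) (just z)
      all-equal 0ℙ 0ℙ 0ℙ = refl
      all-equal 0ℙ 0ℙ 1ℙ = refl
      all-equal 0ℙ 1ℙ 0ℙ = refl
      all-equal 0ℙ 1ℙ 1ℙ = refl
      all-equal 1ℙ 0ℙ 0ℙ = refl
      all-equal 1ℙ 0ℙ 1ℙ = refl
      all-equal 1ℙ 1ℙ 0ℙ = refl
      all-equal 1ℙ 1ℙ 1ℙ = refl

  equiparityCount≡monoTriples : equiparityCount enum A ≡ monoTriples
  equiparityCount≡monoTriples = begin
    equiparityCount enum A
      ≡⟨ length-filter-mapMaybe (equiparity? enum) _ toTriple (cartesianProduct columns (cartesianProduct columns columns)) ⟩
    List.sum (map weight (cartesianProduct columns (cartesianProduct columns columns)))
      ≡⟨ sum-cartesianProduct id (cartesianProduct columns columns) weight ⟩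
    ℕ∑.sum (λ i → List.sum (map (λ jl → weight (i , jl)) (cartesianProduct columns columns)))
      ≡⟨ ℕ∑.sum-cong-≗ (λ i → sum-cartesianProduct id columns (λ jl → weight (i , jl))) ⟩
    ℕ∑.sum (λ i → ℕ∑.sum λ j → List.sum (map (λ l → weight (i , j , l)) columns))
      ≡⟨ ℕ∑.sum-cong-≗ (λ i → ℕ∑.sum-cong-≗ λ j → sum-tabulate id (λ l → weight (i , j , l))) ⟩
    ∑³ (λ i j l → weight (i , j , l))
      ≡⟨ ∑³-cong (λ i j l → increasing (i <? j) (j <? l)) ⟩
    monoTriples ∎
    where
    open ≡-Reasoning
    columns = allFin (suc n)

    square-weight : Triple (suc n) → ℕ
    square-weight (triple i<j j<l) =
      ℕ∑.𝟙 (does (equiparity? enum (latinSquare (<⇒≢ i<j) (<⇒≢ (<-trans i<j j<l)) (<⇒≢ j<l))))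

    -- The default 0 for triples that are not increasing matches the factor `ordered` in
    -- `monoTriples`.
    weight : Fin (suc n) × Fin (suc n) × Fin (suc n) → ℕ
    weight p = maybe′ square-weight 0 (toTriple p)

    increasing : ∀ {i j l} (i<?j : Dec (i < j)) (j<?l : Dec (j < l)) →
      maybe′ square-weight 0
        (Maybe.map (λ (i<j , j<l) → triple i<j j<l) (dec⇒maybe (i<?j ×-dec j<?l))) ≡
      ℕ∑.𝟙 (does i<?j) * ℕ∑.𝟙 (does j<?l) * monochromatic i j l
    increasing (no _)    _         = refl
    increasing (yes _)   (no _)    = refl
    increasing (yes i<j) (yes j<l) =
      trans (equiparity-mono (<⇒≢ i<j) (<⇒≢ (<-trans i<j j<l)) (<⇒≢ j<l))
            (sym (ℕ.*-identityˡ _))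

theorem6p3 : ∀ (n : ℕ) → 2 ≤ n → 4 ∣ n →
    ∀ (Λ : Set) (enum : Λ ↔ Fin n) (A : OrthogonalArray (suc n) n Λ) →
    2 ∣ equiparityCount enum A ×
    n * (n + 1) * (n ∸ 4) ≤ 24 * equiparityCount enum A
theorem6p3 n 2≤n 4∣n Λ enum A =
    subst (2 ∣_) (sym equiparityCount≡monoTriples) (even refl 4∣n 2∣reds)
  , subst (λ c → n * (n + 1) * (n ∸ 4) ≤ 24 * c) (sym equiparityCount≡monoTriples) (lower-bound refl)
  where
  open CompleteArray 2≤n 4∣n enum A
  open Triangles.Coloured colour colour-diag (λ i≢j → _ , colour-≢ i≢j) colour-sym
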